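{- Let $G$ be a finite graph and let $u$ and $v$ be vertices of $G$. In the vertex cover toggle group $T(\mathcal{VC}(G))$, $(t_ut_v)^2=1$ if and only if there is no edge between $u$ and $v$.
   Context: A vertex cover of a graph $G$ is a subset of the vertices such that every edge of $G$ is incident to at least one vertex in the subset; $\mathcal{VC}(G)\subseteq 2^{V(G)}$ is the set of vertex covers. For $v\in V(G)$ the toggle $t_v:\mathcal{VC}(G)\to\mathcal{VC}(G)$ is given by $t_v(X)=X\cup\{v\}$ if $v\notin X$ and $X\cup\{v\}\in\mathcal{VC}(G)$; $t_v(X)=X\setminus\{v\}$ if $v\in X$ and $X\setminus\{v\}\in\mathcal{VC}(G)$; and $t_v(X)=X$ otherwise. $T(\mathcal{VC}(G))$ is the subgroup of the symmetric group on $\mathcal{VC}(G)$ generated by all $t_v$, $v\in V(G)$. -}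

module Defs where

open import Algebra.Bundles using (Group)
open import Algebra.Morphism.Structures using (IsGroupMonomorphism)
import Algebra.Morphism.GroupMonomorphism as GroupMonomorphism
open import Data.Fin.Base using (Fin; zero; suc)
open import Data.Fin.Properties using (all?)
open import Data.Fin.Subset using (Subset; inside; outside; _∈_; _∉_; _∪_; _-_; ⁅_⁆)
open import Data.Fin.Subset.Properties
  using (_∈?_; x∈⁅x⁆; q⊆p∪q; ∪-identityʳ; p─⊥≡p)
open import Data.Irrelevant using ([_])
open import Data.Nat.Base using (ℕ)
open import Data.Product.Base using (Σ; _,_; proj₁; proj₂)
open import Data.Refinement using (Refinement-syntax; value; value-injective; _,_)
open import Data.Sum.Base using (_⊎_)
open import Data.Vec.Base using (_∷_; here; there)
open import Function.Bundles using (_↔_; mk↔ₛ′; module Inverse)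
open import Function.Construct.Composition using (_↔-∘_)
open import Function.Construct.Identity using (↔-id)
open import Function.Construct.Symmetry using (↔-sym)
open import Level using (Level; 0ℓ; _⊔_)
open import Relation.Binary.Core using (Rel)
open import Relation.Binary.Definitions using (Decidable; Irreflexive; Symmetric)
open import Relation.Binary.PropositionalEquality
  using (_≡_; refl; sym; trans; cong; subst)
open import Relation.Nullary using (Dec; yes; no; contradiction)
open import Relation.Nullary.Decidable using (_→-dec_; _⊎-dec_; recompute)
open import Relation.Unary using (Pred)

-- A finite simple graph with vertex set Fin n; adjacency is decidable, as it
-- is for any explicitly given finite graph.
record Graph (n : ℕ) : Set₁ where
  infix 4 _~_ _~?_
  field
    _~_      : Rel (Fin n) 0ℓ
    _~?_     : Decidable _~_
    ~-sym    : Symmetric _~_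
    ~-irrefl : Irreflexive _≡_ _~_

module _ {n : ℕ} (G : Graph n) where
  open Graph G

  IsVertexCover : Pred (Subset n) 0ℓ
  IsVertexCover X = ∀ a b → a ~ b → a ∈ X ⊎ b ∈ X

  isVertexCover? : (X : Subset n) → Dec (IsVertexCover X)
  isVertexCover? X =
    all? λ a → all? λ b → (a ~? b) →-dec ((a ∈? X) ⊎-dec (b ∈? X))

  -- The covering proof is irrelevant, so propositional equality of vertex
  -- covers is equality of the underlying subsets.
  VertexCover : Set
  VertexCover = [ X ∈ Subset n ∣ IsVertexCover X ]

  toggle : Fin n → VertexCover → VertexCover
  toggle v C with v ∈? value C
  toggle v C | no _ with isVertexCover? (value C ∪ ⁅ v ⁆)
  ... | yes cover = (value C ∪ ⁅ v ⁆) , [ cover ]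
  ... | no  _     = C
  toggle v C | yes _ with isVertexCover? (value C - v)
  ... | yes cover = (value C - v) , [ cover ]
  ... | no  _     = C

private
  x∉p-x : ∀ {n} (X : Subset n) v → v ∉ X - v
  x∉p-x (_ ∷ X) zero    ()
  x∉p-x (_ ∷ X) (suc v) (there v∈X-v) = x∉p-x X v v∈X-v

  insert-remove : ∀ {n} (X : Subset n) v → v ∉ X → (X ∪ ⁅ v ⁆) - v ≡ X
  insert-remove (inside  ∷ X) zero v∉X = contradiction here v∉X
  insert-remove (outside ∷ X) zero v∉X =
    cong (outside ∷_) (trans (p─⊥≡p _) (∪-identityʳ X))
  insert-remove (inside  ∷ X) (suc v) v∉X =
    cong (inside ∷_) (insert-remove X v λ v∈X → v∉X (there v∈X))
  insert-remove (outside ∷ X) (suc v) v∉X =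
    cong (outside ∷_) (insert-remove X v λ v∈X → v∉X (there v∈X))

  remove-insert : ∀ {n} (X : Subset n) v → v ∈ X → (X - v) ∪ ⁅ v ⁆ ≡ X
  remove-insert (inside ∷ X) zero here =
    cong (inside ∷_) (trans (∪-identityʳ _) (p─⊥≡p X))
  remove-insert (inside  ∷ X) (suc v) (there v∈X) =
    cong (inside ∷_) (remove-insert X v v∈X)
  remove-insert (outside ∷ X) (suc v) (there v∈X) =
    cong (outside ∷_) (remove-insert X v v∈X)

module _ {n : ℕ} (G : Graph n) where

  toggle-involutive : ∀ v C → toggle G v (toggle G v C) ≡ C
  toggle-involutive v C@(X , [ coverX ]) with v ∈? X
  toggle-involutive v C@(X , [ coverX ]) | no v∉X with isVertexCover? G (X ∪ ⁅ v ⁆)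
  ... | yes _ with v ∈? (X ∪ ⁅ v ⁆)
  ...   | no v∉X∪v = contradiction (q⊆p∪q X ⁅ v ⁆ (x∈⁅x⁆ v)) v∉X∪v
  ...   | yes _ with isVertexCover? G ((X ∪ ⁅ v ⁆) - v)
  ...     | yes _ = value-injective (insert-remove X v v∉X)
  ...     | no ¬cover = contradiction
              (subst (IsVertexCover G) (sym (insert-remove X v v∉X))
                (recompute (isVertexCover? G X) coverX))
              ¬cover
  toggle-involutive v C@(X , [ coverX ]) | no v∉X | no ¬cover with v ∈? X
  ... | yes v∈X = contradiction v∈X v∉X
  ... | no _ with isVertexCover? G (X ∪ ⁅ v ⁆)
  ...   | yes cover = contradiction cover ¬cover
  ...   | no _ = refl
  toggle-involutive v C@(X , [ coverX ]) | yes v∈X with isVertexCover? G (X - v)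
  ... | yes _ with v ∈? (X - v)
  ...   | yes v∈X-v = contradiction v∈X-v (x∉p-x X v)
  ...   | no _ with isVertexCover? G ((X - v) ∪ ⁅ v ⁆)
  ...     | yes _ = value-injective (remove-insert X v v∈X)
  ...     | no ¬cover = contradiction
              (subst (IsVertexCover G) (sym (remove-insert X v v∈X))
                (recompute (isVertexCover? G X) coverX))
              ¬cover
  toggle-involutive v C@(X , [ coverX ]) | yes v∈X | no ¬cover with v ∈? X
  ... | no v∉X = contradiction v∈X v∉X
  ... | yes _ with isVertexCover? G (X - v)
  ...   | yes cover = contradiction cover ¬cover
  ...   | no _ = refl

  toggle↔ : Fin n → VertexCover G ↔ VertexCover G
  toggle↔ v = mk↔ₛ′ (toggle G v) (toggle G v) (toggle-involutive v) (toggle-involutive v)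

-- Products act right to left: (f ∙ g)(x) = f (g x).
Sym : ∀ {a} → Set a → Group a a
Sym A = record
  { Carrier = A ↔ A
  ; _≈_     = λ f g → ∀ x → to f x ≡ to g x
  ; _∙_     = λ f g → f ↔-∘ g
  ; ε       = ↔-id A
  ; _⁻¹     = ↔-sym
  ; isGroup = record
    { isMonoid = record
      { isSemigroup = record
        { isMagma = record
          { isEquivalence = record
            { refl  = λ _ → refl
            ; sym   = λ f≈g x → sym (f≈g x)
            ; trans = λ f≈g g≈h x → trans (f≈g x) (g≈h x)
            }
          ; ∙-cong = λ {f} {f′} {g} {g′} f≈f′ g≈g′ x →
              trans (cong (to f) (g≈g′ x)) (f≈f′ (to g′ x))
          }
        ; assoc = λ _ _ _ _ → refl
        }
      ; identity = (λ _ _ → refl) , (λ _ _ → refl)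
      }
    ; inverse = (λ f → strictlyInverseʳ f) , (λ f → strictlyInverseˡ f)
    ; ⁻¹-cong = λ {f} {g} f≈g x →
        trans (sym (strictlyInverseʳ g (from f x)))
          (cong (from g) (trans (sym (f≈g (from f x))) (strictlyInverseˡ f x)))
    }
  }
  where open Inverse

module _ {c ℓ i} (H : Group c ℓ) {I : Set i} (gen : I → Group.Carrier H) where
  open Group H

  data Generated : Pred Carrier (c ⊔ ℓ ⊔ i) where
    gen∈  : ∀ j → Generated (gen j)
    ε∈    : Generated ε
    ∙∈    : ∀ {x y} → Generated x → Generated y → Generated (x ∙ y)
    ⁻¹∈   : ∀ {x} → Generated x → Generated (x ⁻¹)
    resp  : ∀ {x y} → x ≈ y → Generated x → Generated y

  subgroupGeneratedBy : Group (c ⊔ ℓ ⊔ i) ℓ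
  subgroupGeneratedBy = record
    { Carrier = Σ Carrier Generated
    ; _≈_     = λ x y → proj₁ x ≈ proj₁ y
    ; _∙_     = λ { (x , p) (y , q) → x ∙ y , ∙∈ p q }
    ; ε       = ε , ε∈
    ; _⁻¹     = λ { (x , p) → x ⁻¹ , ⁻¹∈ p }
    ; isGroup = GroupMonomorphism.isGroup inclusion isGroup
    }
    where
    inclusion : IsGroupMonomorphism _ rawGroup proj₁
    inclusion = record
      { isGroupHomomorphism = record
        { isMonoidHomomorphism = record
          { isMagmaHomomorphism = record
            { isRelHomomorphism = record { cong = λ x≈y → x≈y }
            ; homo = λ _ _ → Group.refl H
            }
          ; ε-homo = Group.refl H
          }
        ; ⁻¹-homo = λ _ → Group.refl H
        }
      ; injective = λ x≈y → x≈y
      }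

module _ {n : ℕ} (G : Graph n) where

  ToggleGroup : Group 0ℓ 0ℓ
  ToggleGroup = subgroupGeneratedBy (Sym (VertexCover G)) (toggle↔ G)

  t : Fin n → Group.Carrier ToggleGroup
  t v = toggle↔ G v , gen∈ v

{-# OPTIONS --safe #-}
-- Call v removable from a cover C when C contains v and all its neighbours.
-- The toggle at v changes at most the membership of v, and v lies in t_v(C) iff
-- v is not removable from C.  If u ≠ v are not adjacent, toggling one of them
-- does not affect removability of the other, so the toggles commute; being
-- involutions, their product then squares to 1.  If u ~ v, then starting from
-- the full cover t_u t_v yields a cover containing u and t_v t_u one missing u.
module Submission where

open import Defs
open import Algebra.Bundles using (Group)
open import Data.Fin.Base using (Fin)
open import Data.Fin.Properties using (_≟_)
open import Data.Fin.Subset using (_∈_; _∉_; _⊆_; _∪_; _-_; ⁅_⁆; ⊤)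
open import Data.Fin.Subset.Properties
  using (_∈?_; ∈⊤; p⊆p∪q; q⊆p∪q; x∈⁅x⁆; x∈p∧x≢y⇒x∈p-y; p─q⊆p;
         x∈p⇒p-x⊂p; ⊂-irref; p─q─q≡p─q; ⊆-antisym)
open import Data.Irrelevant using ([_])
open import Data.Nat.Base using (ℕ)
open import Data.Product.Base using (_×_; _,_)
open import Data.Refinement using (value; value-injective; _,_)
open import Data.Sum.Base as Sum using (inj₁; inj₂)
open import Function.Base using (_∘_)
open import Function.Bundles using (_⇔_; mk⇔)
open import Relation.Binary.PropositionalEquality
open import Relation.Nullary using (¬_; yes; no; contradiction)
open import Relation.Nullary.Decidable using (recompute)

-- Deleting a member strictly shrinks a set, yet deleting `x` a second time changes nothing.
x∉p-x : ∀ {n} {p} (x : Fin n) → x ∉ p - x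
x∉p-x {p = p} x x∈p-x = ⊂-irref (p─q─q≡p─q p ⁅ x ⁆) (x∈p⇒p-x⊂p x∈p-x)

module _ {n : ℕ} (G : Graph n) where
  open Graph G

  -- Covering is decidable, so the irrelevant proof stored in `C` can be recomputed into a usable
  -- one.
  isCover : ∀ C → IsVertexCover G (value C)
  isCover (X , [ cover ]) = recompute (isVertexCover? G X) cover

  full : VertexCover G
  full = ⊤ , [ (λ _ _ _ → inj₁ ∈⊤) ]

  Removable : Fin n → VertexCover G → Set
  Removable v C = v ∈ value C × (∀ b → v ~ b → b ∈ value C)

  ~⇒≢ : ∀ {u v} → u ~ v → u ≢ v
  ~⇒≢ u~v u≡v = ~-irrefl u≡v u~v

  insert-isCover : ∀ v C → IsVertexCover G (value C ∪ ⁅ v ⁆)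
  insert-isCover v C a b a~b = Sum.map (p⊆p∪q _) (p⊆p∪q _) (isCover C a b a~b)

  -- An edge at `v` stays covered by its other end, which lies in `C` and differs from `v` since
  -- there are no loops.
  remove-isCover : ∀ {v C} → Removable v C → IsVertexCover G (value C - v)
  remove-isCover {v} {C} (_ , nbrs) a b a~b with a ≟ v | b ≟ v
  ... | yes refl | _        = inj₂ (x∈p∧x≢y⇒x∈p-y (nbrs b a~b) (≢-sym (~⇒≢ a~b)))
  ... | no _     | yes refl = inj₁ (x∈p∧x≢y⇒x∈p-y (nbrs a (~-sym a~b)) (~⇒≢ a~b))
  ... | no a≢v   | no b≢v   =
    Sum.map (λ a∈C → x∈p∧x≢y⇒x∈p-y a∈C a≢v) (λ b∈C → x∈p∧x≢y⇒x∈p-y b∈C b≢v)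
      (isCover C a b a~b)

  remove-isCover⁻ : ∀ {v C} → v ∈ value C → IsVertexCover G (value C - v) → Removable v C
  remove-isCover⁻ {v} {C} v∈C cover = v∈C , nbrs
    where
    nbrs : ∀ b → v ~ b → b ∈ value C
    nbrs b v~b with cover v b v~b
    ... | inj₁ v∈C-v = contradiction v∈C-v (x∉p-x v)
    ... | inj₂ b∈C-v = p─q⊆p _ _ b∈C-v

  toggle-other⁺ : ∀ {v w} C → w ≢ v → w ∈ value C → w ∈ value (toggle G v C)
  toggle-other⁺ {v} C w≢v w∈C with v ∈? value C
  toggle-other⁺ {v} C w≢v w∈C | no _ with isVertexCover? G (value C ∪ ⁅ v ⁆)
  ... | yes _ = p⊆p∪q _ w∈C
  ... | no  _ = w∈C
  toggle-other⁺ {v} C w≢v w∈C | yes _ with isVertexCover? G (value C - v)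
  ... | yes _ = x∈p∧x≢y⇒x∈p-y w∈C w≢v
  ... | no  _ = w∈C

  -- The forward direction at `toggle G v C` suffices, since toggling again restores `C`.
  toggle-other⁻ : ∀ {v w} C → w ≢ v → w ∈ value (toggle G v C) → w ∈ value C
  toggle-other⁻ {v} {w} C w≢v w∈tC =
    subst (λ D → w ∈ value D) (toggle-involutive G v C)
      (toggle-other⁺ (toggle G v C) w≢v w∈tC)

  removable⇒∉toggle : ∀ {v} C → Removable v C → v ∉ value (toggle G v C)
  removable⇒∉toggle {v} C r@(v∈C , _) with v ∈? value C
  ... | no v∉C = contradiction v∈C v∉C
  ... | yes _ with isVertexCover? G (value C - v)
  ...   | yes _     = x∉p-x v
  ...   | no ¬cover = contradiction (remove-isCover {C = C} r) ¬cover

  -- If `v` is absent, its insertion always succeeds because supersets of covers are covers; if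
  -- present, its deletion would leave some edge uncovered and is refused.
  ¬removable⇒∈toggle : ∀ {v} C → ¬ Removable v C → v ∈ value (toggle G v C)
  ¬removable⇒∈toggle {v} C ¬r with v ∈? value C
  ¬removable⇒∈toggle {v} C ¬r | no _ with isVertexCover? G (value C ∪ ⁅ v ⁆)
  ... | yes _     = q⊆p∪q _ _ (x∈⁅x⁆ v)
  ... | no ¬cover = contradiction (insert-isCover v C) ¬cover
  ¬removable⇒∈toggle {v} C ¬r | yes v∈C with isVertexCover? G (value C - v)
  ... | yes cover = contradiction (remove-isCover⁻ {C = C} v∈C cover) ¬r
  ... | no _      = v∈C

  toggle-removable⁺ : ∀ {u v} C → u ≢ v → ¬ (u ~ v) →
    Removable u C → Removable u (toggle G v C)
  toggle-removable⁺ {v = v} C u≢v u≁v (u∈C , nbrs) =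
    toggle-other⁺ C u≢v u∈C ,
    λ b u~b → toggle-other⁺ {v} C (λ { refl → u≁v u~b }) (nbrs b u~b)

  toggle-removable⁻ : ∀ {u v} C → u ≢ v → ¬ (u ~ v) →
    Removable u (toggle G v C) → Removable u C
  toggle-removable⁻ {u} {v} C u≢v u≁v r =
    subst (Removable u) (toggle-involutive G v C)
      (toggle-removable⁺ (toggle G v C) u≢v u≁v r)

  -- Membership is compared vertex by vertex. At `u` and `v` it is decided by removability, which
  -- the other toggle preserves; elsewhere neither toggle acts. One inclusion is enough, as the
  -- hypotheses are symmetric in `u` and `v`.
  toggle-comm-⊆ : ∀ {u v} C → u ≢ v → ¬ (u ~ v) →
    value (toggle G u (toggle G v C)) ⊆ value (toggle G v (toggle G u C))
  toggle-comm-⊆ {u} {v} C u≢v u≁v {w} w∈ with w ≟ u | w ≟ v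
  ... | yes refl | _ = toggle-other⁺ (toggle G u C) u≢v
    (¬removable⇒∈toggle C λ r →
      removable⇒∉toggle (toggle G v C) (toggle-removable⁺ C u≢v u≁v r) w∈)
  ... | no w≢u | yes refl = ¬removable⇒∈toggle (toggle G u C) λ r →
    removable⇒∉toggle C (toggle-removable⁻ C w≢u (u≁v ∘ ~-sym) r)
      (toggle-other⁻ (toggle G v C) w≢u w∈)
  ... | no w≢u | no w≢v =
    toggle-other⁺ (toggle G u C) w≢v (toggle-other⁺ C w≢u
      (toggle-other⁻ C w≢v (toggle-other⁻ (toggle G v C) w≢u w∈)))

  toggle-comm : ∀ {u v} → ¬ (u ~ v) → ∀ C →
    toggle G u (toggle G v C) ≡ toggle G v (toggle G u C)
  toggle-comm {u} {v} u≁v C with u ≟ v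
  ... | yes refl = refl
  ... | no u≢v   = value-injective (⊆-antisym
    (toggle-comm-⊆ C u≢v u≁v) (toggle-comm-⊆ C (≢-sym u≢v) (u≁v ∘ ~-sym)))

  ~⇒toggle-noncomm : ∀ {u v} → u ~ v →
    toggle G u (toggle G v full) ≢ toggle G v (toggle G u full)
  ~⇒toggle-noncomm {u} {v} u~v eq =
    removable⇒∉toggle full (∈⊤ , λ _ _ → ∈⊤)
      (toggle-other⁻ (toggle G u full) (~⇒≢ u~v) (subst (λ C → u ∈ value C) eq u∈))
    where
    u∈ : u ∈ value (toggle G u (toggle G v full))
    -- Toggling `v` deletes it from the full cover, so `u` has lost a neighbour and cannot be
    -- removed.
    u∈ = ¬removable⇒∈toggle (toggle G v full) λ (_ , nbrs) →
      removable⇒∉toggle full (∈⊤ , λ _ _ → ∈⊤) (nbrs v u~v)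

lemma3p26 : ∀ {n : ℕ} (G : Graph n) (u v : Fin n) →
    let open Graph G
        open Group (ToggleGroup G) in
    ((t G u ∙ t G v) ∙ (t G u ∙ t G v)) ≈ ε ⇔ (¬ (u ~ v))
lemma3p26 G u v = mk⇔
  -- The relation is needed at the full cover only, where adjacent toggles already fail to commute.
  (λ square≈ε u~v → ~⇒toggle-noncomm G u~v (commute (square≈ε (full G))))
  (λ u≁v C → begin
    tog u (tog v (tog u (tog v C))) ≡⟨ cong (tog u ∘ tog v) (toggle-comm G u≁v C) ⟩
    tog u (tog v (tog v (tog u C))) ≡⟨ cong (tog u) (toggle-involutive G v (tog u C)) ⟩
    tog u (tog u C)                 ≡⟨ toggle-involutive G u C ⟩
    C                               ∎)
  where
  open ≡-Reasoning
  tog : Fin _ → VertexCover G → VertexCover G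
  tog = toggle G

  -- Applying `tog v ∘ tog u` to both sides of the hypothesis cancels the two outermost toggles on
  -- the left.
  commute : ∀ {C} → tog u (tog v (tog u (tog v C))) ≡ C → tog u (tog v C) ≡ tog v (tog u C)
  commute {C} eq = begin
    tog u (tog v C)                                 ≡⟨ toggle-involutive G v _ ⟨
    tog v (tog v (tog u (tog v C)))                 ≡⟨ cong (tog v) (toggle-involutive G u _) ⟨
    tog v (tog u (tog u (tog v (tog u (tog v C))))) ≡⟨ cong (tog v ∘ tog u) eq ⟩
    tog v (tog u C)                                 ∎
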